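{- Let $G^{\phi}$ be a $3$-regular optimum Hermitian energy mixed graph whose underlying graph $G$ is the complete graph $K_4$. Then, up to isomorphism of mixed graphs and switching equivalence, $G^{\phi}$ is one of $D_1$ and $G_1$; that is, $G^{\phi}$ is isomorphic to a mixed graph that is switching equivalent to $D_1$ or to $G_1$. Here both $D_1$ and $G_1$ have vertex set $\{u_1,u_2,u_3,u_4\}$ and underlying graph $K_4$, where: $D_1$ is the oriented graph with arcs $u_1\to u_2,\ u_1\to u_3,\ u_1\to u_4,\ u_2\to u_3,\ u_3\to u_4,\ u_4\to u_2$; $G_1$ has undirected edges $u_1\leftrightarrow u_2,\ u_1\leftrightarrow u_3,\ u_1\leftrightarrow u_4$ and arcs $u_2\to u_3,\ u_3\to u_4,\ u_4\to u_2$.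
   Context: A mixed graph $G^{\phi}$ is obtained from a finite simple undirected graph $G$ (its underlying graph) by choosing a subset $S\subseteq E(G)$ and giving each edge of $S$ an orientation. Oriented edges are arcs, written $u\to v$, and the edges not in $S$ remain undirected, written $u\leftrightarrow v$. If $S=E(G)$, $G^\phi$ is an oriented graph. Degree, regularity, order, etc. refer to the underlying graph. The Hermitian-adjacency matrix $H(G^\phi)=(h_{kl})$ has $h_{kl}=h_{lk}=1$ if $k\leftrightarrow l$, $h_{kl}=i$ and $h_{lk}=-i$ if $k\to l$, and $h_{kl}=0$ otherwise, where $i$ is the imaginary unit. The Hermitian energy $\mathcal{E}_H(G^\phi)$ is the sum of the absolute values of the eigenvalues of $H(G^\phi)$ (equivalently, the sum of its singular values). A mixed graph on $n$ vertices with maximum degree $\Delta$ is an optimum Hermitian energy mixed graph if $\mathcal{E}_H(G^\phi)=n\sqrt{\Delta}$. Two mixed graphs $G^{\phi_1},G^{\phi_2}$ with the same underlying graph and the same vertex set are switching equivalent if there is a diagonal matrix $D$ with all diagonal entries in $\{1,-1\}$ such that $H(G^{\phi_2})=D^{ -1}H(G^{\phi_1})D$. An isomorphism of mixed graphs is a bijection of vertex sets that preserves (in both directions) undirected edges and arcs with their directions. -}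

module Defs where

open import Algebra.Bundles.Raw using (RawRing)
import Algebra.Definitions.RawMonoid as RawMonoidOps
open import Data.Bool.Base using (Bool; true; false; T; if_then_else_; _∧_; not)
open import Data.Bool.Properties using (T?) renaming (_≟_ to _≟ᵇ_)
open import Data.Fin.Base using (Fin; zero; suc; punchIn)
open import Data.Fin.Patterns using (0F; 1F; 2F; 3F)
open import Data.Fin.Permutation using (Permutation; _⟨$⟩ʳ_)
open import Data.Fin.Properties using (all?) renaming (_≟_ to _≟ᶠ_)
open import Data.Fin.Subset using (∣_∣)
open import Data.Integer.Base using (+_)
open import Data.Nat.Base as ℕ using (ℕ)
import Data.Nat.Properties as ℕ
open import Data.Product.Base using (_×_; _,_; ∃; ∃-syntax; ∃₂; proj₁; proj₂)
open import Data.Rational.Base as ℚ using (ℚ; 0ℚ; 1ℚ; ½)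
import Data.Rational.Properties as ℚ
open import Data.Rational.Solver using (module +-*-Solver)
open import Data.Sum.Base using (_⊎_; inj₁; inj₂)
import Data.Vec.Base as Vec
import Data.Vec.Functional as Vector
open import Level using (0ℓ)
open import Relation.Binary.PropositionalEquality
  using (_≡_; refl; sym; trans; cong; cong₂; subst; module ≡-Reasoning)
open import Relation.Nullary.Decidable using (yes; no; ⌊_⌋; from-yes; ¬?; _→-dec_)
open import Relation.Nullary.Negation using (¬_; contradiction)

private
  variable
    m n : ℕ

Cauchy : (ℕ → ℚ) → Set
Cauchy x = ∀ ε → 0ℚ ℚ.< ε →
  ∃[ N ] (∀ i j → N ℕ.≤ i → N ℕ.≤ j → ℚ.∣ x i ℚ.- x j ∣ ℚ.< ε)

0<1 : 0ℚ ℚ.< 1ℚ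
0<1 = from-yes (0ℚ ℚ.<? 1ℚ)

half-pos : ∀ {ε} → 0ℚ ℚ.< ε → 0ℚ ℚ.< ½ ℚ.* ε
half-pos {ε} 0<ε =
  subst (ℚ._< ½ ℚ.* ε) (ℚ.*-zeroʳ ½) (ℚ.*-monoʳ-<-pos ½ 0<ε)

half+half : ∀ ε → ½ ℚ.* ε ℚ.+ ½ ℚ.* ε ≡ ε
half+half ε =
  trans (sym (ℚ.*-distribʳ-+ ε ½ ½)) (ℚ.*-identityˡ ε)

const-cauchy : ∀ q → Cauchy (λ _ → q)
const-cauchy q ε 0<ε = 0 , λ _ _ _ _ →
  subst (λ t → ℚ.∣ t ∣ ℚ.< ε) (sym (ℚ.+-inverseʳ q)) 0<ε

+-cauchy : ∀ x y → Cauchy x → Cauchy y → Cauchy (λ k → x k ℚ.+ y k)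
+-cauchy x y cx cy ε 0<ε =
  let (M , p) = cx (½ ℚ.* ε) (half-pos 0<ε)
      (N , q) = cy (½ ℚ.* ε) (half-pos 0<ε)
  in M ℕ.⊔ N , λ i j M⊔N≤i M⊔N≤j → let open ℚ.≤-Reasoning in begin-strict
    ℚ.∣ (x i ℚ.+ y i) ℚ.- (x j ℚ.+ y j) ∣
      ≡⟨ cong ℚ.∣_∣ (rearrange (x i) (y i) (x j) (y j)) ⟩
    ℚ.∣ (x i ℚ.- x j) ℚ.+ (y i ℚ.- y j) ∣
      ≤⟨ ℚ.∣p+q∣≤∣p∣+∣q∣ (x i ℚ.- x j) (y i ℚ.- y j) ⟩
    ℚ.∣ x i ℚ.- x j ∣ ℚ.+ ℚ.∣ y i ℚ.- y j ∣
      <⟨ ℚ.+-mono-<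
           (p i j (ℕ.m⊔n≤o⇒m≤o M N M⊔N≤i) (ℕ.m⊔n≤o⇒m≤o M N M⊔N≤j))
           (q i j (ℕ.m⊔n≤o⇒n≤o M N M⊔N≤i) (ℕ.m⊔n≤o⇒n≤o M N M⊔N≤j)) ⟩
    ½ ℚ.* ε ℚ.+ ½ ℚ.* ε
      ≡⟨ half+half ε ⟩
    ε ∎
  where
  open +-*-Solver
  rearrange : ∀ a b c d →
    (a ℚ.+ b) ℚ.- (c ℚ.+ d) ≡ (a ℚ.- c) ℚ.+ (b ℚ.- d)
  rearrange = solve 4
    (λ a b c d → (a :+ b) :- (c :+ d) := (a :- c) :+ (b :- d)) refl

neg-cauchy : ∀ x → Cauchy x → Cauchy (λ k → ℚ.- x k)
neg-cauchy x cx ε 0<ε =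
  let (N , p) = cx ε 0<ε
  in N , λ i j N≤i N≤j →
    subst (ℚ._< ε)
      (trans (sym (ℚ.∣-p∣≡∣p∣ (x i ℚ.- x j)))
             (cong ℚ.∣_∣ (ℚ.neg-distrib-+ (x i) (ℚ.- x j))))
      (p i j N≤i N≤j)

abs-cauchy : ∀ x → Cauchy x → Cauchy (λ k → ℚ.∣ x k ∣)
abs-cauchy x cx ε 0<ε =
  let (N , p) = cx ε 0<ε
  in N , λ i j N≤i N≤j →
    ℚ.≤-<-trans (reverse-triangle (x i) (x j)) (p i j N≤i N≤j)
  where
  open +-*-Solver

  one-sided : ∀ a b → ℚ.∣ a ∣ ℚ.- ℚ.∣ b ∣ ℚ.≤ ℚ.∣ a ℚ.- b ∣
  one-sided a b = let open ℚ.≤-Reasoning in begin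
    ℚ.∣ a ∣ ℚ.- ℚ.∣ b ∣
      ≡⟨ cong (λ t → ℚ.∣ t ∣ ℚ.- ℚ.∣ b ∣)
           (solve 2 (λ a b → a := (a :- b) :+ b) refl a b) ⟩
    ℚ.∣ (a ℚ.- b) ℚ.+ b ∣ ℚ.- ℚ.∣ b ∣
      ≤⟨ ℚ.+-monoˡ-≤ (ℚ.- ℚ.∣ b ∣) (ℚ.∣p+q∣≤∣p∣+∣q∣ (a ℚ.- b) b) ⟩
    (ℚ.∣ a ℚ.- b ∣ ℚ.+ ℚ.∣ b ∣) ℚ.- ℚ.∣ b ∣
      ≡⟨ solve 2 (λ u v → (u :+ v) :- v := u) refl ℚ.∣ a ℚ.- b ∣ ℚ.∣ b ∣ ⟩
    ℚ.∣ a ℚ.- b ∣ ∎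

  swap : ∀ a b → ℚ.- (a ℚ.- b) ≡ b ℚ.- a
  swap = solve 2 (λ a b → :- (a :- b) := b :- a) refl

  reverse-triangle : ∀ a b → ℚ.∣ ℚ.∣ a ∣ ℚ.- ℚ.∣ b ∣ ∣ ℚ.≤ ℚ.∣ a ℚ.- b ∣
  reverse-triangle a b with ℚ.∣p∣≡p∨∣p∣≡-p (ℚ.∣ a ∣ ℚ.- ℚ.∣ b ∣)
  ... | inj₁ e = subst (ℚ._≤ ℚ.∣ a ℚ.- b ∣) (sym e) (one-sided a b)
  ... | inj₂ e = let open ℚ.≤-Reasoning in begin
    ℚ.∣ ℚ.∣ a ∣ ℚ.- ℚ.∣ b ∣ ∣     ≡⟨ e ⟩
    ℚ.- (ℚ.∣ a ∣ ℚ.- ℚ.∣ b ∣)     ≡⟨ swap ℚ.∣ a ∣ ℚ.∣ b ∣ ⟩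
    ℚ.∣ b ∣ ℚ.- ℚ.∣ a ∣           ≤⟨ one-sided b a ⟩
    ℚ.∣ b ℚ.- a ∣                 ≡⟨ cong ℚ.∣_∣ (sym (swap a b)) ⟩
    ℚ.∣ ℚ.- (a ℚ.- b) ∣           ≡⟨ ℚ.∣-p∣≡∣p∣ (a ℚ.- b) ⟩
    ℚ.∣ a ℚ.- b ∣                 ∎

eventually-bounded : ∀ x → Cauchy x →
  ∃₂ λ B N → 0ℚ ℚ.< B × (∀ i → N ℕ.≤ i → ℚ.∣ x i ∣ ℚ.< B)
eventually-bounded x cx =
  let (N , p) = cx 1ℚ 0<1
  in 1ℚ ℚ.+ ℚ.∣ x N ∣ , N
   , ℚ.+-mono-<-≤ 0<1 (ℚ.0≤∣p∣ (x N))
   , λ i N≤i → let open ℚ.≤-Reasoning in begin-strict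
       ℚ.∣ x i ∣
         ≡⟨ cong ℚ.∣_∣ (solve 2 (λ a b → a := (a :- b) :+ b) refl (x i) (x N)) ⟩
       ℚ.∣ (x i ℚ.- x N) ℚ.+ x N ∣
         ≤⟨ ℚ.∣p+q∣≤∣p∣+∣q∣ (x i ℚ.- x N) (x N) ⟩
       ℚ.∣ x i ℚ.- x N ∣ ℚ.+ ℚ.∣ x N ∣
         <⟨ ℚ.+-monoˡ-< ℚ.∣ x N ∣ (p i N N≤i ℕ.≤-refl) ⟩
       1ℚ ℚ.+ ℚ.∣ x N ∣ ∎
  where open +-*-Solver

*-bound : ∀ {a b B δ} → 0ℚ ℚ.< δ →
  ℚ.∣ a ∣ ℚ.< B → ℚ.∣ b ∣ ℚ.< δ → ℚ.∣ a ℚ.* b ∣ ℚ.< B ℚ.* δ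
*-bound {a} {b} {B} {δ} 0<δ a<B b<δ = let open ℚ.≤-Reasoning in begin-strict
  ℚ.∣ a ℚ.* b ∣          ≡⟨ ℚ.∣p*q∣≡∣p∣*∣q∣ a b ⟩
  ℚ.∣ a ∣ ℚ.* ℚ.∣ b ∣
    ≤⟨ ℚ.*-monoˡ-≤-nonNeg ℚ.∣ a ∣ {{ℚ.∣-∣-nonNeg a}} (ℚ.<⇒≤ b<δ) ⟩
  ℚ.∣ a ∣ ℚ.* δ          <⟨ ℚ.*-monoˡ-<-pos δ {{ℚ.positive 0<δ}} a<B ⟩
  B ℚ.* δ                ∎

divide : ∀ B ε → 0ℚ ℚ.< B → 0ℚ ℚ.< ε → ∃[ δ ] (0ℚ ℚ.< δ × B ℚ.* δ ≡ ε)
divide B ε 0<B 0<ε = ε ℚ.* B⁻¹ , 0<δ , (let open ≡-Reasoning in begin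
    B ℚ.* (ε ℚ.* B⁻¹)   ≡⟨ solve 3 (λ b e i → b :* (e :* i) := e :* (b :* i)) refl B ε B⁻¹ ⟩
    ε ℚ.* (B ℚ.* B⁻¹)   ≡⟨ cong (ε ℚ.*_) (ℚ.*-inverseʳ B) ⟩
    ε ℚ.* 1ℚ            ≡⟨ ℚ.*-identityʳ ε ⟩
    ε                   ∎)
  where
  open +-*-Solver
  instance
    B-pos = ℚ.positive 0<B
    B-nonZero = ℚ.pos⇒nonZero B
  B⁻¹ = ℚ.1/ B
  instance
    B⁻¹-pos = ℚ.1/pos⇒pos B
  0<δ : 0ℚ ℚ.< ε ℚ.* B⁻¹
  0<δ = subst (ℚ._< ε ℚ.* B⁻¹) (ℚ.*-zeroˡ B⁻¹) (ℚ.*-monoˡ-<-pos B⁻¹ 0<ε)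

*-cauchy : ∀ x y → Cauchy x → Cauchy y → Cauchy (λ k → x k ℚ.* y k)
*-cauchy x y cx cy ε 0<ε =
  let (A , K , 0<A , x<A) = eventually-bounded x cx
      (B , L , 0<B , y<B) = eventually-bounded y cy
      (α , 0<α , Bα≡)     = divide B (½ ℚ.* ε) 0<B (half-pos 0<ε)
      (β , 0<β , Aβ≡)     = divide A (½ ℚ.* ε) 0<A (half-pos 0<ε)
      (M , p)             = cx α 0<α
      (N , q)             = cy β 0<β
  in (K ℕ.⊔ L) ℕ.⊔ (M ℕ.⊔ N) , λ i j ≤i ≤j →
    let KL≤i = ℕ.m⊔n≤o⇒m≤o (K ℕ.⊔ L) (M ℕ.⊔ N) ≤i
        KL≤j = ℕ.m⊔n≤o⇒m≤o (K ℕ.⊔ L) (M ℕ.⊔ N) ≤j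
        MN≤i = ℕ.m⊔n≤o⇒n≤o (K ℕ.⊔ L) (M ℕ.⊔ N) ≤i
        MN≤j = ℕ.m⊔n≤o⇒n≤o (K ℕ.⊔ L) (M ℕ.⊔ N) ≤j
        open ℚ.≤-Reasoning
    in begin-strict
    ℚ.∣ x i ℚ.* y i ℚ.- x j ℚ.* y j ∣
      ≡⟨ cong ℚ.∣_∣ (rearrange (x i) (y i) (x j) (y j)) ⟩
    ℚ.∣ x i ℚ.* (y i ℚ.- y j) ℚ.+ y j ℚ.* (x i ℚ.- x j) ∣
      ≤⟨ ℚ.∣p+q∣≤∣p∣+∣q∣ (x i ℚ.* (y i ℚ.- y j)) (y j ℚ.* (x i ℚ.- x j)) ⟩
    ℚ.∣ x i ℚ.* (y i ℚ.- y j) ∣ ℚ.+ ℚ.∣ y j ℚ.* (x i ℚ.- x j) ∣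
      <⟨ ℚ.+-mono-<
           (*-bound {x i} 0<β (x<A i (ℕ.m⊔n≤o⇒m≤o K L KL≤i))
             (q i j (ℕ.m⊔n≤o⇒n≤o M N MN≤i) (ℕ.m⊔n≤o⇒n≤o M N MN≤j)))
           (*-bound {y j} 0<α (y<B j (ℕ.m⊔n≤o⇒n≤o K L KL≤j))
             (p i j (ℕ.m⊔n≤o⇒m≤o M N MN≤i) (ℕ.m⊔n≤o⇒m≤o M N MN≤j))) ⟩
    A ℚ.* β ℚ.+ B ℚ.* α
      ≡⟨ cong₂ ℚ._+_ Aβ≡ Bα≡ ⟩
    ½ ℚ.* ε ℚ.+ ½ ℚ.* ε
      ≡⟨ half+half ε ⟩
    ε ∎
  where
  open +-*-Solver
  rearrange : ∀ a b c d →
    a ℚ.* b ℚ.- c ℚ.* d ≡ a ℚ.* (b ℚ.- d) ℚ.+ d ℚ.* (a ℚ.- c)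
  rearrange = solve 4
    (λ a b c d → a :* b :- c :* d := a :* (b :- d) :+ d :* (a :- c)) refl

-- Real numbers are Cauchy sequences of rationals, compared by _≃ʳ_ and not
-- by propositional equality.
record ℝ : Set where
  constructor mkℝ
  field
    seq    : ℕ → ℚ
    cauchy : Cauchy seq

open ℝ public

infix  4 _≃ʳ_ _≤ʳ_
infixl 6 _+ʳ_
infixl 7 _*ʳ_
infix  8 -ʳ_

_≃ʳ_ : ℝ → ℝ → Set
x ≃ʳ y = ∀ ε → 0ℚ ℚ.< ε →
  ∃[ N ] (∀ k → N ℕ.≤ k → ℚ.∣ seq x k ℚ.- seq y k ∣ ℚ.< ε)

_≤ʳ_ : ℝ → ℝ → Set
x ≤ʳ y = ∀ ε → 0ℚ ℚ.< ε →
  ∃[ N ] (∀ k → N ℕ.≤ k → seq x k ℚ.< seq y k ℚ.+ ε)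

fromℚ : ℚ → ℝ
fromℚ q = mkℝ (λ _ → q) (const-cauchy q)

fromℕ : ℕ → ℝ
fromℕ k = fromℚ (+ k ℚ./ 1)

0ʳ 1ʳ : ℝ
0ʳ = fromℚ 0ℚ
1ʳ = fromℚ 1ℚ

_+ʳ_ : ℝ → ℝ → ℝ
x +ʳ y = mkℝ (λ k → seq x k ℚ.+ seq y k) (+-cauchy (seq x) (seq y) (cauchy x) (cauchy y))

_*ʳ_ : ℝ → ℝ → ℝ
x *ʳ y = mkℝ (λ k → seq x k ℚ.* seq y k) (*-cauchy (seq x) (seq y) (cauchy x) (cauchy y))

-ʳ_ : ℝ → ℝ
-ʳ x = mkℝ (λ k → ℚ.- seq x k) (neg-cauchy (seq x) (cauchy x))

∣_∣ʳ : ℝ → ℝ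
∣ x ∣ʳ = mkℝ (λ k → ℚ.∣ seq x k ∣) (abs-cauchy (seq x) (cauchy x))

-- s = √x.  A relation, since no square root function is defined.
IsSqrt : ℝ → ℝ → Set
IsSqrt s x = 0ʳ ≤ʳ s × s *ʳ s ≃ʳ x

ℝ-rawRing : RawRing 0ℓ 0ℓ
ℝ-rawRing = record
  { Carrier = ℝ ; _≈_ = _≃ʳ_ ; _+_ = _+ʳ_ ; _*_ = _*ʳ_
  ; -_ = -ʳ_ ; 0# = 0ʳ ; 1# = 1ʳ }

open RawMonoidOps (RawRing.+-rawMonoid ℝ-rawRing) public
  using () renaming (sum to sumʳ)

infix  4 _≃ᶜ_
infix  5 _+i_
infixl 6 _+ᶜ_ _-ᶜ_
infixl 7 _*ᶜ_
infix  8 -ᶜ_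

record ℂ : Set where
  constructor _+i_
  field
    re im : ℝ

open ℂ public

_≃ᶜ_ : ℂ → ℂ → Set
z ≃ᶜ w = re z ≃ʳ re w × im z ≃ʳ im w

0ᶜ 1ᶜ iᶜ : ℂ
0ᶜ = 0ʳ +i 0ʳ
1ᶜ = 1ʳ +i 0ʳ
iᶜ = 0ʳ +i 1ʳ

-ᶜ_ : ℂ → ℂ
-ᶜ z = (-ʳ re z) +i (-ʳ im z)

_+ᶜ_ _-ᶜ_ _*ᶜ_ : ℂ → ℂ → ℂ
z +ᶜ w = (re z +ʳ re w) +i (im z +ʳ im w)
z -ᶜ w = z +ᶜ (-ᶜ w)
z *ᶜ w = (re z *ʳ re w +ʳ (-ʳ (im z *ʳ im w))) +i
         (re z *ʳ im w +ʳ im z *ʳ re w)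

fromℝ : ℝ → ℂ
fromℝ x = x +i 0ʳ

ℂ-rawRing : RawRing 0ℓ 0ℓ
ℂ-rawRing = record
  { Carrier = ℂ ; _≈_ = _≃ᶜ_ ; _+_ = _+ᶜ_ ; _*_ = _*ᶜ_
  ; -_ = -ᶜ_ ; 0# = 0ᶜ ; 1# = 1ᶜ }

open RawMonoidOps (RawRing.+-rawMonoid ℂ-rawRing) public
  using () renaming (sum to sumᶜ)
open RawMonoidOps (RawRing.*-rawMonoid ℂ-rawRing) public
  using () renaming (sum to productᶜ)

Matrix : ℕ → Set
Matrix n = Fin n → Fin n → ℂ

infix  4 _≃ᴹ_
infixl 7 _*ᴹ_

_≃ᴹ_ : Matrix n → Matrix n → Set
A ≃ᴹ B = ∀ k l → A k l ≃ᶜ B k l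

_*ᴹ_ : Matrix n → Matrix n → Matrix n
(A *ᴹ B) k l = sumᶜ λ j → A k j *ᶜ B j l

diag : (Fin n → ℂ) → Matrix n
diag d k l = if ⌊ k ≟ᶠ l ⌋ then d k else 0ᶜ

1ᴹ : Matrix n
1ᴹ = diag λ _ → 1ᶜ

-- (-1)ʲ z
alternate : Fin n → ℂ → ℂ
alternate zero    z = z
alternate (suc j) z = -ᶜ alternate j z

-- Laplace expansion along the first row
det : Matrix n → ℂ
det {ℕ.zero}  A = 1ᶜ
det {ℕ.suc n} A =
  sumᶜ λ j → alternate j (A zero j *ᶜ det (λ k l → A (suc k) (punchIn j l)))

-- The eigenvalues of A, listed with multiplicity, are the real numbers μ:
-- det (zI − A) = ∏ⱼ (z − μⱼ), an identity of polynomials in z.  Real μ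
-- suffice because this is only applied to Hermitian matrices.
HasEigenvalues : Matrix n → (Fin n → ℝ) → Set
HasEigenvalues A μ = ∀ z →
  det (λ k l → diag (λ _ → z) k l -ᶜ A k l) ≃ᶜ productᶜ (λ j → z -ᶜ fromℝ (μ j))

record SimpleGraph (n : ℕ) : Set where
  field
    adj        : Fin n → Fin n → Bool
    adj-sym    : ∀ u v → adj u v ≡ adj v u
    adj-irrefl : ∀ v → adj v v ≡ false

open SimpleGraph public

degree : SimpleGraph n → Fin n → ℕ
degree G v = ∣ Vec.tabulate (adj G v) ∣

maxDegree : SimpleGraph n → ℕ
maxDegree G = Vector.foldr ℕ._⊔_ 0 (degree G)

Regular : ℕ → SimpleGraph n → Set
Regular r G = ∀ v → degree G v ≡ r

infix 4 _≅ᴳ_ _≅_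

_≅ᴳ_ : SimpleGraph m → SimpleGraph n → Set
_≅ᴳ_ {m} {n} G G′ = ∃ λ (π : Permutation m n) →
  ∀ u v → adj G u v ≡ adj G′ (π ⟨$⟩ʳ u) (π ⟨$⟩ʳ v)

K : ∀ n → SimpleGraph n
K n = record
  { adj        = λ u v → not ⌊ u ≟ᶠ v ⌋
  ; adj-sym    = K-sym
  ; adj-irrefl = K-irrefl
  }
  where
  K-sym : ∀ (u v : Fin n) → not ⌊ u ≟ᶠ v ⌋ ≡ not ⌊ v ≟ᶠ u ⌋
  K-sym u v with u ≟ᶠ v | v ≟ᶠ u
  ... | yes _ | yes _ = refl
  ... | no _  | no _  = refl
  ... | yes p | no q  = contradiction (sym p) q
  ... | no p  | yes q = contradiction (sym q) p
  K-irrefl : ∀ (v : Fin n) → not ⌊ v ≟ᶠ v ⌋ ≡ false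
  K-irrefl v with v ≟ᶠ v
  ... | yes _ = refl
  ... | no p  = contradiction refl p

-- The oriented edges are those uv with arc u v or arc v u; the remaining
-- edges of the underlying graph are undirected.
record MixedGraph (n : ℕ) : Set where
  field
    underlying : SimpleGraph n
    arc        : Fin n → Fin n → Bool
    arc⇒adj    : ∀ u v → T (arc u v) → T (adj underlying u v)
    arc-asym   : ∀ u v → T (arc u v) → ¬ T (arc v u)

open MixedGraph public

undirected : MixedGraph n → Fin n → Fin n → Bool
undirected M u v = adj (underlying M) u v ∧ not (arc M u v) ∧ not (arc M v u)

_≅_ : MixedGraph m → MixedGraph n → Set
_≅_ {m} {n} M M′ = ∃ λ (π : Permutation m n) → ∀ u v →
  undirected M u v ≡ undirected M′ (π ⟨$⟩ʳ u) (π ⟨$⟩ʳ v) ×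
  arc M u v ≡ arc M′ (π ⟨$⟩ʳ u) (π ⟨$⟩ʳ v)

hermitianAdjacency : MixedGraph n → Matrix n
hermitianAdjacency M k l =
  if undirected M k l then 1ᶜ else
  if arc M k l then iᶜ else
  if arc M l k then -ᶜ iᶜ else
  0ᶜ

-- A relation between M and e: the eigenvalues are not computed but given as
-- a list μ.
HermitianEnergy : MixedGraph n → ℝ → Set
HermitianEnergy M e = ∃ λ μ →
  HasEigenvalues (hermitianAdjacency M) μ × e ≃ʳ sumʳ (λ j → ∣ μ j ∣ʳ)

OptimumHermitianEnergy : MixedGraph n → Set
OptimumHermitianEnergy {n} M = ∃ λ √Δ →
  IsSqrt √Δ (fromℕ (maxDegree (underlying M))) ×
  HermitianEnergy M (fromℕ n *ʳ √Δ)

-- D = diag d has entries ±1, and D⁻¹ is any two-sided inverse of it.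
SwitchingEquivalent : MixedGraph n → MixedGraph n → Set
SwitchingEquivalent {n} M M′ =
  (∀ u v → adj (underlying M) u v ≡ adj (underlying M′) u v) ×
  ∃ λ (d : Fin n → ℂ) → ∃ λ (D⁻¹ : Matrix n) →
    (∀ k → d k ≃ᶜ 1ᶜ ⊎ d k ≃ᶜ -ᶜ 1ᶜ) ×
    (D⁻¹ *ᴹ diag d ≃ᴹ 1ᴹ × diag d *ᴹ D⁻¹ ≃ᴹ 1ᴹ) ×
    hermitianAdjacency M′ ≃ᴹ D⁻¹ *ᴹ hermitianAdjacency M *ᴹ diag d

-- The vertices u₁, u₂, u₃, u₄ are 0F, 1F, 2F, 3F.
arcs-D₁ : Fin 4 → Fin 4 → Bool
arcs-D₁ 0F 1F = true
arcs-D₁ 0F 2F = true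
arcs-D₁ 0F 3F = true
arcs-D₁ 1F 2F = true
arcs-D₁ 2F 3F = true
arcs-D₁ 3F 1F = true
arcs-D₁ _  _  = false

arcs-G₁ : Fin 4 → Fin 4 → Bool
arcs-G₁ 1F 2F = true
arcs-G₁ 2F 3F = true
arcs-G₁ 3F 1F = true
arcs-G₁ _  _  = false

D₁ : MixedGraph 4
D₁ = record
  { underlying = K 4
  ; arc        = arcs-D₁
  ; arc⇒adj    = from-yes (all? λ u → all? λ v →
                   T? (arcs-D₁ u v) →-dec T? (adj (K 4) u v))
  ; arc-asym   = from-yes (all? λ u → all? λ v →
                   T? (arcs-D₁ u v) →-dec ¬? (T? (arcs-D₁ v u)))
  }

G₁ : MixedGraph 4
G₁ = record
  { underlying = K 4
  ; arc        = arcs-G₁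
  ; arc⇒adj    = from-yes (all? λ u → all? λ v →
                   T? (arcs-G₁ u v) →-dec T? (adj (K 4) u v))
  ; arc-asym   = from-yes (all? λ u → all? λ v →
                   T? (arcs-G₁ u v) →-dec ¬? (T? (arcs-G₁ v u)))
  }

-- The eigenvalues μⱼ of H satisfy Σ μⱼ² = tr H² = 12 and, by optimality,
-- Σ |μⱼ| = 4√3, so Σ (|μⱼ| − √3)² = 0 and every μⱼ² = 3.  Hence the
-- characteristic polynomial p has p(z) p(−z) = ∏ⱼ (μⱼ² − z²) = (3 − z²)⁴.
-- Its values at integers are integers that depend only on which of the 3⁶
-- mixed graphs on K₄ is given, and p(0)² = 81, p(1) p(−1) = 16 leave
-- 24 of them, each of which is switched to D₁ or G₁ after a relabelling.
-- Everything about H is computed over the Gaussian integers ℤ[i].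

{-# OPTIONS --safe #-}
module Submission where

open import Defs
open import Algebra.Bundles.Raw using (RawRing)
import Algebra.Definitions.RawMonoid as RawMonoidOps
import Algebra.Properties.Group as GroupProperties
open import Data.Bool.Base using (Bool; true; false; T; if_then_else_; _∧_; not)
open import Data.Fin.Base using (Fin; zero; suc; punchIn)
open import Data.Fin.Patterns using (0F; 1F; 2F; 3F)
open import Data.Fin.Permutation as Perm
  using (Permutation; _⟨$⟩ʳ_; _⟨$⟩ˡ_; _∘ₚ_; transpose; flip; ↔⇒≡)
open import Data.Fin.Properties using (all?; any?) renaming (_≟_ to _≟ᶠ_)
open import Data.Integer.Base as ℤ using (ℤ; +_; -[1+_])
import Data.Integer.Properties as ℤ
open import Data.Nat.Base as ℕ using (ℕ)
import Data.Nat.Coprimality as Coprime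
import Data.Nat.Properties as ℕ
open import Data.Product.Base using (∃; ∃-syntax; _×_; _,_; proj₁; proj₂)
open import Data.Product.Properties using (≡-dec)
open import Data.Rational.Base as ℚ using (ℚ; mkℚ; 0ℚ; 1ℚ; ½)
import Data.Rational.Properties as ℚ
open import Data.Rational.Solver using (module +-*-Solver)
open import Data.Sum.Base using (_⊎_; inj₁; inj₂)
open import Data.Unit.Base using (tt)
open import Data.Vec.Base using (Vec; []; _∷_; lookup)
open import Level using (0ℓ)
open import Relation.Binary.Definitions using (tri<; tri≈; tri>)
open import Relation.Binary.PropositionalEquality
  using (_≡_; refl; sym; trans; cong; cong₂; subst)
open import Relation.Nullary.Decidable
  using (Dec; yes; no; ⌊_⌋; map′; from-yes; _×-dec_; _⊎-dec_; _→-dec_)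
open import Relation.Nullary.Negation using (¬_; contradiction)

open +-*-Solver using (Polynomial; solve; con; _:=_; _:+_; _:*_; _:-_; :-_)

-- Null sequences of rationals

-- `x ≃ʳ y` unfolds to `Vanishes` of the termwise difference, so congruence laws for reals become
-- closure laws for null sequences.
Vanishes : (ℕ → ℚ) → Set
Vanishes f = ∀ ε → 0ℚ ℚ.< ε → ∃[ N ] (∀ k → N ℕ.≤ k → ℚ.∣ f k ∣ ℚ.< ε)

vanishes-dominated : ∀ {f g} → (∀ k → ℚ.∣ f k ∣ ℚ.≤ ℚ.∣ g k ∣) → Vanishes g → Vanishes f
vanishes-dominated f≤g vg ε 0<ε =
  let (N , p) = vg ε 0<ε in N , λ k N≤k → ℚ.≤-<-trans (f≤g k) (p k N≤k)

vanishes-resp : ∀ {f g} → (∀ k → f k ≡ g k) → Vanishes g → Vanishes f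
vanishes-resp f≡g = vanishes-dominated λ k → ℚ.≤-reflexive (cong ℚ.∣_∣ (f≡g k))

vanishes-0 : Vanishes (λ _ → 0ℚ)
vanishes-0 ε 0<ε = 0 , λ _ _ → 0<ε

vanishes-neg : ∀ {f} → Vanishes f → Vanishes (λ k → ℚ.- f k)
vanishes-neg {f} = vanishes-dominated λ k → ℚ.≤-reflexive (ℚ.∣-p∣≡∣p∣ (f k))

vanishes-+ : ∀ {f g} → Vanishes f → Vanishes g → Vanishes (λ k → f k ℚ.+ g k)
vanishes-+ {f} {g} vf vg ε 0<ε =
  let (M , p) = vf (½ ℚ.* ε) (half-pos 0<ε)
      (N , q) = vg (½ ℚ.* ε) (half-pos 0<ε)
  in M ℕ.⊔ N , λ k M⊔N≤k →
    ℚ.≤-<-trans (ℚ.∣p+q∣≤∣p∣+∣q∣ (f k) (g k))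
      (subst (ℚ.∣ f k ∣ ℚ.+ ℚ.∣ g k ∣ ℚ.<_) (half+half ε)
        (ℚ.+-mono-< (p k (ℕ.m⊔n≤o⇒m≤o M N M⊔N≤k)) (q k (ℕ.m⊔n≤o⇒n≤o M N M⊔N≤k))))

-- A Cauchy sequence is eventually below some `B`, so it suffices to make `g` smaller than `ε / B`.
vanishes-* : ∀ {f g} → Cauchy f → Vanishes g → Vanishes (λ k → f k ℚ.* g k)
vanishes-* {f} {g} cf vg ε 0<ε =
  let (B , M , 0<B , f<B) = eventually-bounded f cf
      (δ , 0<δ , Bδ≡ε)    = divide B ε 0<B 0<ε
      (N , q)             = vg δ 0<δ
  in M ℕ.⊔ N , λ k M⊔N≤k →
    subst (ℚ.∣ f k ℚ.* g k ∣ ℚ.<_) Bδ≡ε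
      (*-bound {f k} 0<δ (f<B k (ℕ.m⊔n≤o⇒m≤o M N M⊔N≤k)) (q k (ℕ.m⊔n≤o⇒n≤o M N M⊔N≤k)))

-- Where `∣ f k ∣` is at least `ε`, its square is at least `ε * ε`; the threshold of the squares for
-- `ε * ε` therefore serves `f` for `ε`.
vanishes-√ : ∀ {f} → Vanishes (λ k → f k ℚ.* f k) → Vanishes f
vanishes-√ {f} v ε 0<ε = N , λ k N≤k → ℚ.≰⇒> λ ε≤∣f∣ →
    ℚ.<-irrefl refl (ℚ.<-≤-trans (p k N≤k) (square-mono (f k) ε≤∣f∣))
  where
  0<ε² : 0ℚ ℚ.< ε ℚ.* ε
  0<ε² = subst (ℚ._< ε ℚ.* ε) (ℚ.*-zeroˡ ε) (ℚ.*-monoˡ-<-pos ε {{ℚ.positive 0<ε}} 0<ε)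
  N = proj₁ (v (ε ℚ.* ε) 0<ε²)
  p = proj₂ (v (ε ℚ.* ε) 0<ε²)
  square-mono : ∀ x → ε ℚ.≤ ℚ.∣ x ∣ → ε ℚ.* ε ℚ.≤ ℚ.∣ x ℚ.* x ∣
  square-mono x ε≤∣x∣ = let open ℚ.≤-Reasoning in begin
    ε ℚ.* ε               ≤⟨ ℚ.*-monoʳ-≤-nonNeg ε {{ℚ.nonNegative (ℚ.<⇒≤ 0<ε)}} ε≤∣x∣ ⟩
    ℚ.∣ x ∣ ℚ.* ε         ≤⟨ ℚ.*-monoˡ-≤-nonNeg ℚ.∣ x ∣ {{ℚ.∣-∣-nonNeg x}} ε≤∣x∣ ⟩
    ℚ.∣ x ∣ ℚ.* ℚ.∣ x ∣   ≡⟨ ℚ.∣p*q∣≡∣p∣*∣q∣ x x ⟨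
    ℚ.∣ x ℚ.* x ∣         ∎

-- A nonzero `q` would contradict the definition at `ε = ∣ q ∣`. This is what turns an equality of
-- reals into an exact one.
vanishes-const : ∀ {q} → Vanishes (λ _ → q) → q ≡ 0ℚ
vanishes-const {q} v with ℚ.<-cmp 0ℚ ℚ.∣ q ∣
... | tri< 0<∣q∣ _ _ =
  let (N , p) = v ℚ.∣ q ∣ 0<∣q∣ in contradiction (p N ℕ.≤-refl) (ℚ.<-irrefl refl)
... | tri≈ _ 0≡∣q∣ _ = ℚ.∣p∣≡0⇒p≡0 q (sym 0≡∣q∣)
... | tri> _ _ ∣q∣<0 = contradiction (ℚ.<-≤-trans ∣q∣<0 (ℚ.0≤∣p∣ q)) (ℚ.<-irrefl refl)

-- Congruence laws for real and complex equality

infix 4 _≈ʳ_ _≈ᶜ_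

-- _≃ʳ_ and _≃ᶜ_ wrapped as records, so that Agda can infer their arguments.
-- Re-wrapping as in ⟪ close p ⟫ changes the arguments to definitionally equal
-- ones by comparing only the sequences: comparing two reals would also unfold
-- their Cauchy proofs, which does not finish in reasonable time.
record _≈ʳ_ (x y : ℝ) : Set where
  constructor ⟪_⟫
  field close : x ≃ʳ y

open _≈ʳ_

record _≈ᶜ_ (z w : ℂ) : Set where
  constructor _+i≈_
  field
    re≈ : re z ≈ʳ re w
    im≈ : im z ≈ʳ im w

open _≈ᶜ_

pointwise : ∀ {x y} → (∀ k → seq x k ≡ seq y k) → x ≈ʳ y
pointwise {x} {y} x≡y = ⟪ vanishes-resp
  (λ k → trans (cong (ℚ._- seq y k) (x≡y k)) (ℚ.+-inverseʳ (seq y k))) vanishes-0 ⟫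

≈ʳ-sym : ∀ {x y} → x ≈ʳ y → y ≈ʳ x
≈ʳ-sym {x} {y} ⟪ x≃y ⟫ = ⟪ vanishes-resp
  (λ k → solve 2 (λ a b → b :- a := :- (a :- b)) refl (seq x k) (seq y k))
  (vanishes-neg x≃y) ⟫

≈ʳ-trans : ∀ {x y z} → x ≈ʳ y → y ≈ʳ z → x ≈ʳ z
≈ʳ-trans {x} {y} {z} ⟪ x≃y ⟫ ⟪ y≃z ⟫ = ⟪ vanishes-resp
  (λ k → solve 3 (λ a b c → a :- c := (a :- b) :+ (b :- c)) refl (seq x k) (seq y k) (seq z k))
  (vanishes-+ x≃y y≃z) ⟫

+ʳ-cong : ∀ {x x′ y y′} → x ≈ʳ x′ → y ≈ʳ y′ → x +ʳ y ≈ʳ x′ +ʳ y′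
+ʳ-cong {x} {x′} {y} {y′} ⟪ x≃x′ ⟫ ⟪ y≃y′ ⟫ = ⟪ vanishes-resp
  (λ k → solve 4 (λ a a′ b b′ → (a :+ b) :- (a′ :+ b′) := (a :- a′) :+ (b :- b′)) refl
           (seq x k) (seq x′ k) (seq y k) (seq y′ k))
  (vanishes-+ x≃x′ y≃y′) ⟫

-ʳ-cong : ∀ {x y} → x ≈ʳ y → -ʳ x ≈ʳ -ʳ y
-ʳ-cong {x} {y} ⟪ x≃y ⟫ = ⟪ vanishes-resp
  (λ k → solve 2 (λ a b → :- a :- :- b := :- (a :- b)) refl (seq x k) (seq y k))
  (vanishes-neg x≃y) ⟫

*ʳ-cong : ∀ {x x′ y y′} → x ≈ʳ x′ → y ≈ʳ y′ → x *ʳ y ≈ʳ x′ *ʳ y′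
*ʳ-cong {x} {x′} {y} {y′} ⟪ x≃x′ ⟫ ⟪ y≃y′ ⟫ = ⟪ vanishes-resp
  (λ k → solve 4 (λ a a′ b b′ →
             a :* b :- a′ :* b′ := a :* (b :- b′) :+ b′ :* (a :- a′)) refl
           (seq x k) (seq x′ k) (seq y k) (seq y′ k))
  (vanishes-+ (vanishes-* {seq x} (cauchy x) y≃y′) (vanishes-* {seq y′} (cauchy y′) x≃x′)) ⟫

open RawMonoidOps (RawRing.*-rawMonoid ℝ-rawRing) using () renaming (sum to productʳ)

*ᶜ-cong : ∀ {z z′ w w′} → z ≈ᶜ z′ → w ≈ᶜ w′ → z *ᶜ w ≈ᶜ z′ *ᶜ w′
*ᶜ-cong (r +i≈ i) (r′ +i≈ i′) =
  ⟪ close (+ʳ-cong (*ʳ-cong r r′) (-ʳ-cong (*ʳ-cong i i′))) ⟫ +i≈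
  ⟪ close (+ʳ-cong (*ʳ-cong r i′) (*ʳ-cong i r′)) ⟫

fromℝ-* : ∀ {z w x y} → z ≈ᶜ fromℝ x → w ≈ᶜ fromℝ y → z *ᶜ w ≈ᶜ fromℝ (x *ʳ y)
fromℝ-* {x = x} {y} z≈x w≈y =
  ⟪ close (≈ʳ-trans (re≈ step) (pointwise {y = x *ʳ y} λ k →
    solve 2 (λ a b → a :* b :+ :- (con 0ℚ :* con 0ℚ) := a :* b) refl (seq x k) (seq y k))) ⟫ +i≈
  ⟪ close (≈ʳ-trans (im≈ step) (pointwise {y = 0ʳ} λ k →
    solve 2 (λ a b → a :* con 0ℚ :+ con 0ℚ :* b := con 0ℚ) refl (seq x k) (seq y k))) ⟫
  where step = *ᶜ-cong z≈x w≈y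

-- Needed to read the eigenvalue identity at a real point as an identity between reals.
productᶜ-fromℝ : ∀ {n} {f : Fin n → ℂ} {g : Fin n → ℝ} →
  (∀ j → f j ≈ᶜ fromℝ (g j)) → productᶜ f ≈ᶜ fromℝ (productʳ g)
productᶜ-fromℝ {ℕ.zero}  f≈g = pointwise (λ _ → refl) +i≈ pointwise (λ _ → refl)
productᶜ-fromℝ {ℕ.suc n} f≈g = ⟪ close (re≈ step) ⟫ +i≈ ⟪ close (im≈ step) ⟫
  where step = fromℝ-* (f≈g zero) (productᶜ-fromℝ λ j → f≈g (suc j))

-- Exact matrix arithmetic over the Gaussian integers

ℤ[i] : Set
ℤ[i] = ℤ × ℤ

infixl 6 _+ᶻ_
infixl 7 _*ᶻ_
infix  8 -ᶻ_

0ᶻ 1ᶻ iᶻ : ℤ[i]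
0ᶻ = + 0 , + 0
1ᶻ = + 1 , + 0
iᶻ = + 0 , + 1

-ᶻ_ : ℤ[i] → ℤ[i]
-ᶻ (a , b) = ℤ.- a , ℤ.- b

_+ᶻ_ _*ᶻ_ : ℤ[i] → ℤ[i] → ℤ[i]
(a , b) +ᶻ (c , d) = a ℤ.+ c , b ℤ.+ d
(a , b) *ᶻ (c , d) = a ℤ.* c ℤ.- b ℤ.* d , a ℤ.* d ℤ.+ b ℤ.* c

_≟ᶻ_ : (z w : ℤ[i]) → Dec (z ≡ w)
_≟ᶻ_ = ≡-dec ℤ._≟_ ℤ._≟_

ℤ[i]-rawRing : RawRing 0ℓ 0ℓ
ℤ[i]-rawRing = record
  { Carrier = ℤ[i] ; _≈_ = _≡_ ; _+_ = _+ᶻ_ ; _*_ = _*ᶻ_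
  ; -_ = -ᶻ_ ; 0# = 0ᶻ ; 1# = 1ᶻ }

open RawMonoidOps (RawRing.+-rawMonoid ℤ[i]-rawRing) using () renaming (sum to sumᶻ)

Matrixᶻ : ℕ → Set
Matrixᶻ n = Fin n → Fin n → ℤ[i]

infixl 7 _*ᴹᶻ_

_*ᴹᶻ_ : ∀ {n} → Matrixᶻ n → Matrixᶻ n → Matrixᶻ n
(A *ᴹᶻ B) k l = sumᶻ λ j → A k j *ᶻ B j l

diagᶻ : ∀ {n} → (Fin n → ℤ[i]) → Matrixᶻ n
diagᶻ d k l = if ⌊ k ≟ᶠ l ⌋ then d k else 0ᶻ

alternateᶻ : ∀ {n} → Fin n → ℤ[i] → ℤ[i]
alternateᶻ zero    z = z
alternateᶻ (suc j) z = -ᶻ alternateᶻ j z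

detᶻ : ∀ {n} → Matrixᶻ n → ℤ[i]
detᶻ {ℕ.zero}  A = 1ᶻ
detᶻ {ℕ.suc n} A =
  sumᶻ λ j → alternateᶻ j (A zero j *ᶻ detᶻ (λ k l → A (suc k) (punchIn j l)))

-- Transfer between Gaussian integers and complex numbers

-- The second field is the denominator minus one. Using the constructor instead of a normalising
-- fraction makes `ℚ.↥ (ι a)` reduce to `a`.
ι : ℤ → ℚ
ι a = mkℚ a 0 (Coprime.sym (Coprime.1-coprimeTo ℤ.∣ a ∣))

ι-+ : ∀ a b → ι (a ℤ.+ b) ≡ ι a ℚ.+ ι b
ι-+ a b = sym (trans
  (cong₂ (λ x y → (x ℤ.+ y) ℚ./ 1) (ℤ.*-identityʳ a) (ℤ.*-identityʳ b))
  (ℚ.↥p/↧p≡p (ι (a ℤ.+ b))))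

ι-* : ∀ a b → ι (a ℤ.* b) ≡ ι a ℚ.* ι b
ι-* a b = sym (ℚ.↥p/↧p≡p (ι (a ℤ.* b)))

ι-neg : ∀ a → ι (ℤ.- a) ≡ ℚ.- ι a
ι-neg (+ 0)       = refl
ι-neg (+ ℕ.suc _) = refl
ι-neg -[1+ _ ]    = refl

fromℤ : ℤ → ℝ
fromℤ a = fromℚ (ι a)

infix 4 _≈ᶻ_ _≐_ _≐ᴹ_

-- The integer is an index of the record, so that unification can recover it.
record _≈ᶻ_ (x : ℝ) (a : ℤ) : Set where
  constructor ⟪_⟫ᶻ
  field closeᶻ : x ≃ʳ fromℤ a

open _≈ᶻ_

≈ᶻ⇒≈ʳ : ∀ {x a} → x ≈ᶻ a → x ≈ʳ fromℤ a
≈ᶻ⇒≈ʳ ⟪ x≃a ⟫ᶻ = ⟪ x≃a ⟫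

≈ᶻ-resp : ∀ {x y a} → x ≈ʳ y → y ≈ᶻ a → x ≈ᶻ a
≈ᶻ-resp x≈y y≈a = ⟪ close (≈ʳ-trans x≈y (≈ᶻ⇒≈ʳ y≈a)) ⟫ᶻ

≈ᶻ-pointwise : ∀ {x a} → (∀ k → seq x k ≡ ι a) → x ≈ᶻ a
≈ᶻ-pointwise {x} {a} x≡a = ⟪ close (pointwise {x} {fromℤ a} x≡a) ⟫ᶻ

-- The constant sequence `ι a - ι b` is null, hence zero. Real identities between values of the
-- characteristic polynomial thereby become integer identities.
≈ᶻ-injective : ∀ {x a b} → x ≈ᶻ a → x ≈ᶻ b → a ≡ b
≈ᶻ-injective {a = a} {b} x≈a x≈b = cong ℚ.↥_ (x∙y⁻¹≈ε⇒x≈y (ι a) (ι b) (vanishes-const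
  (close (≈ʳ-trans (≈ʳ-sym (≈ᶻ⇒≈ʳ x≈a)) (≈ᶻ⇒≈ʳ x≈b)))))
  where open GroupProperties ℚ.+-0-group using (x∙y⁻¹≈ε⇒x≈y)

fromℤ-neg : ∀ a → -ʳ fromℤ a ≈ʳ fromℤ (ℤ.- a)
fromℤ-neg a = pointwise λ _ → sym (ι-neg a)

fromℤ-+ : ∀ a b → fromℤ a +ʳ fromℤ b ≈ʳ fromℤ (a ℤ.+ b)
fromℤ-+ a b = pointwise λ _ → sym (ι-+ a b)

fromℤ-* : ∀ a b → fromℤ a *ʳ fromℤ b ≈ʳ fromℤ (a ℤ.* b)
fromℤ-* a b = pointwise λ _ → sym (ι-* a b)

≈ᶻ-neg : ∀ {x a} → x ≈ᶻ a → -ʳ x ≈ᶻ ℤ.- a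
≈ᶻ-neg {a = a} x≈a = ⟪ close (≈ʳ-trans (-ʳ-cong (≈ᶻ⇒≈ʳ x≈a)) (fromℤ-neg a)) ⟫ᶻ

≈ᶻ-+ : ∀ {x y a b} → x ≈ᶻ a → y ≈ᶻ b → x +ʳ y ≈ᶻ a ℤ.+ b
≈ᶻ-+ {a = a} {b} x≈a y≈b =
  ⟪ close (≈ʳ-trans (+ʳ-cong (≈ᶻ⇒≈ʳ x≈a) (≈ᶻ⇒≈ʳ y≈b)) (fromℤ-+ a b)) ⟫ᶻ

≈ᶻ-* : ∀ {x y a b} → x ≈ᶻ a → y ≈ᶻ b → x *ʳ y ≈ᶻ a ℤ.* b
≈ᶻ-* {a = a} {b} x≈a y≈b =
  ⟪ close (≈ʳ-trans (*ʳ-cong (≈ᶻ⇒≈ʳ x≈a) (≈ᶻ⇒≈ʳ y≈b)) (fromℤ-* a b)) ⟫ᶻ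

-- A logical relation: preserved by the ring operations, it is preserved by `det` and `_*ᴹ_`, so
-- that claims about complex matrices reduce to closed computations.
record _≐_ (z : ℂ) (w : ℤ[i]) : Set where
  constructor _+i≐_
  field
    re≐ : re z ≈ᶻ proj₁ w
    im≐ : im z ≈ᶻ proj₂ w

open _≐_

-- Brings an identity decided over `ℤ[i]` back to `ℂ`.
≐-cancel : ∀ {z z′ w} → z ≐ w → z′ ≐ w → z ≃ᶜ z′
≐-cancel (r +i≐ i) (r′ +i≐ i′) =
  close (≈ʳ-trans (≈ᶻ⇒≈ʳ r) (≈ʳ-sym (≈ᶻ⇒≈ʳ r′))) ,
  close (≈ʳ-trans (≈ᶻ⇒≈ʳ i) (≈ʳ-sym (≈ᶻ⇒≈ʳ i′)))

0ᶜ≐0ᶻ : 0ᶜ ≐ 0ᶻ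
0ᶜ≐0ᶻ = ≈ᶻ-pointwise (λ _ → refl) +i≐ ≈ᶻ-pointwise (λ _ → refl)

1ᶜ≐1ᶻ : 1ᶜ ≐ 1ᶻ
1ᶜ≐1ᶻ = ≈ᶻ-pointwise (λ _ → refl) +i≐ ≈ᶻ-pointwise (λ _ → refl)

iᶜ≐iᶻ : iᶜ ≐ iᶻ
iᶜ≐iᶻ = ≈ᶻ-pointwise (λ _ → refl) +i≐ ≈ᶻ-pointwise (λ _ → refl)

≐-neg : ∀ {z w} → z ≐ w → -ᶜ z ≐ -ᶻ w
≐-neg (r +i≐ i) = ⟪ closeᶻ (≈ᶻ-neg r) ⟫ᶻ +i≐ ⟪ closeᶻ (≈ᶻ-neg i) ⟫ᶻ

≐-+ : ∀ {z z′ w w′} → z ≐ w → z′ ≐ w′ → z +ᶜ z′ ≐ w +ᶻ w′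
≐-+ (r +i≐ i) (r′ +i≐ i′) = ⟪ closeᶻ (≈ᶻ-+ r r′) ⟫ᶻ +i≐ ⟪ closeᶻ (≈ᶻ-+ i i′) ⟫ᶻ

≐-* : ∀ {z z′ w w′} → z ≐ w → z′ ≐ w′ → z *ᶜ z′ ≐ w *ᶻ w′
≐-* (r +i≐ i) (r′ +i≐ i′) =
  ⟪ closeᶻ (≈ᶻ-+ (≈ᶻ-* r r′) (≈ᶻ-neg (≈ᶻ-* i i′))) ⟫ᶻ +i≐
  ⟪ closeᶻ (≈ᶻ-+ (≈ᶻ-* r i′) (≈ᶻ-* i r′)) ⟫ᶻ

≐-sum : ∀ {n} {f : Fin n → ℂ} {g : Fin n → ℤ[i]} → (∀ j → f j ≐ g j) → sumᶜ f ≐ sumᶻ g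
≐-sum {ℕ.zero}  f≐g = ≈ᶻ-pointwise (λ _ → refl) +i≐ ≈ᶻ-pointwise (λ _ → refl)
≐-sum {ℕ.suc n} f≐g = ⟪ closeᶻ (re≐ step) ⟫ᶻ +i≐ ⟪ closeᶻ (im≐ step) ⟫ᶻ
  where step = ≐-+ (f≐g zero) (≐-sum λ j → f≐g (suc j))

≐-alternate : ∀ {n} (j : Fin n) {z w} → z ≐ w → alternate j z ≐ alternateᶻ j w
≐-alternate zero    z≐w = z≐w
≐-alternate (suc j) z≐w = ≐-neg (≐-alternate j z≐w)

_≐ᴹ_ : ∀ {n} → Matrix n → Matrixᶻ n → Set
A ≐ᴹ B = ∀ k l → A k l ≐ B k l

≐-det : ∀ {n} {A : Matrix n} {B} → A ≐ᴹ B → det A ≐ detᶻ B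
≐-det {ℕ.zero}  A≐B = 1ᶜ≐1ᶻ
≐-det {ℕ.suc n} A≐B = ⟪ closeᶻ (re≐ step) ⟫ᶻ +i≐ ⟪ closeᶻ (im≐ step) ⟫ᶻ
  where
  step = ≐-sum λ j → ≐-alternate j
    (≐-* (A≐B zero j) (≐-det λ k l → A≐B (suc k) (punchIn j l)))

≐-*ᴹ : ∀ {n} {A A′ : Matrix n} {B B′} → A ≐ᴹ B → A′ ≐ᴹ B′ → A *ᴹ A′ ≐ᴹ B *ᴹᶻ B′
≐-*ᴹ A≐B A′≐B′ k l = ⟪ closeᶻ (re≐ step) ⟫ᶻ +i≐ ⟪ closeᶻ (im≐ step) ⟫ᶻ
  where step = ≐-sum λ j → ≐-* (A≐B k j) (A′≐B′ j l)

≐-diag : ∀ {n} {d : Fin n → ℂ} {e} → (∀ k → d k ≐ e k) → diag d ≐ᴹ diagᶻ e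
≐-diag d≐e k l with ⌊ k ≟ᶠ l ⌋
... | true  = d≐e k
... | false = 0ᶜ≐0ᶻ

-- The characteristic polynomial at integers

-- The polynomial is represented by its values at integers. The real part is taken because it is to
-- be compared with ∏ⱼ (z - μⱼ), where `z` and the μⱼ are real.
charpoly : ∀ {n} → Matrixᶻ n → ℤ → ℤ
charpoly A z = proj₁ (detᶻ λ k l → diagᶻ (λ _ → z , + 0) k l +ᶻ -ᶻ A k l)

-- The eigenvalue identity is instantiated at an integer: its right side is then a real product, and
-- its left side is computed by `detᶻ`.
charpoly-roots : ∀ {n} (A : Matrix n) (B : Matrixᶻ n) (μ : Fin n → ℝ) →
  A ≐ᴹ B → HasEigenvalues A μ →
  ∀ z → productʳ (λ j → fromℤ z +ʳ -ʳ μ j) ≈ᶻ charpoly B z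
charpoly-roots A B μ A≐B eigenvalues z =
  ⟪ close (≈ʳ-trans (≈ʳ-sym (re≈ (productᶜ-fromℝ factor)))
      (≈ʳ-trans (≈ʳ-sym det≈product) (≈ᶻ⇒≈ʳ (re≐ (≐-det shifted))))) ⟫ᶻ
  where
  det≈product : re (det (λ k l → diag (λ _ → fromℝ (fromℤ z)) k l -ᶜ A k l)) ≈ʳ
                re (productᶜ (λ j → fromℝ (fromℤ z) -ᶜ fromℝ (μ j)))
  det≈product = ⟪ proj₁ (eigenvalues (fromℝ (fromℤ z))) ⟫
  shifted : (λ k l → diag (λ _ → fromℝ (fromℤ z)) k l -ᶜ A k l) ≐ᴹ
            (λ k l → diagᶻ (λ _ → z , + 0) k l +ᶻ -ᶻ B k l)
  shifted k l = ⟪ closeᶻ (re≐ step) ⟫ᶻ +i≐ ⟪ closeᶻ (im≐ step) ⟫ᶻ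
    where
    z≐z : ∀ k → fromℝ (fromℤ z) ≐ (z , + 0)
    z≐z _ = ≈ᶻ-pointwise (λ _ → refl) +i≐ ≈ᶻ-pointwise (λ _ → refl)
    step = ≐-+ (≐-diag z≐z k l) (≐-neg (A≐B k l))
  factor : ∀ j → fromℝ (fromℤ z) -ᶜ fromℝ (μ j) ≈ᶜ fromℝ (fromℤ z +ʳ -ʳ μ j)
  factor j = pointwise (λ _ → refl) +i≈ pointwise (λ _ → refl)

-- Finite search, and codes for mixed graphs on K₄

module _ {m : ℕ} where

  all-vec? : ∀ n {P : Vec (Fin m) n → Set} → (∀ v → Dec (P v)) → Dec (∀ v → P v)
  all-vec? ℕ.zero    P? = map′ (λ { p [] → p }) (λ p → p []) (P? [])
  all-vec? (ℕ.suc n) P? = map′ (λ { p (x ∷ v) → p x v }) (λ p x v → p (x ∷ v))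
    (all? λ x → all-vec? n λ v → P? (x ∷ v))

  any-vec? : ∀ n {P : Vec (Fin m) n → Set} → (∀ v → Dec (P v)) → Dec (∃ P)
  any-vec? ℕ.zero    P? = map′ ([] ,_) (λ { ([] , p) → p }) (P? [])
  any-vec? (ℕ.suc n) P? = map′ (λ { (x , v , p) → x ∷ v , p }) (λ { (x ∷ v , p) → x , v , p })
    (any? λ x → any-vec? n λ v → P? (x ∷ v))

-- The orientations of the edges 01, 02, 03, 12, 13, 23, each of which is
-- undirected (0F), directed upwards (1F) or directed downwards (2F).
Code : Set
Code = Vec (Fin 3) 6

up down : Fin 3 → Bool
up 1F = true
up _  = false
down 2F = true
down _  = false

arcs : Code → Fin 4 → Fin 4 → Bool
arcs (a ∷ _ ∷ _ ∷ _ ∷ _ ∷ _ ∷ []) 0F 1F = up a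
arcs (_ ∷ b ∷ _ ∷ _ ∷ _ ∷ _ ∷ []) 0F 2F = up b
arcs (_ ∷ _ ∷ c ∷ _ ∷ _ ∷ _ ∷ []) 0F 3F = up c
arcs (_ ∷ _ ∷ _ ∷ d ∷ _ ∷ _ ∷ []) 1F 2F = up d
arcs (_ ∷ _ ∷ _ ∷ _ ∷ e ∷ _ ∷ []) 1F 3F = up e
arcs (_ ∷ _ ∷ _ ∷ _ ∷ _ ∷ f ∷ []) 2F 3F = up f
arcs (a ∷ _ ∷ _ ∷ _ ∷ _ ∷ _ ∷ []) 1F 0F = down a
arcs (_ ∷ b ∷ _ ∷ _ ∷ _ ∷ _ ∷ []) 2F 0F = down b
arcs (_ ∷ _ ∷ c ∷ _ ∷ _ ∷ _ ∷ []) 3F 0F = down c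
arcs (_ ∷ _ ∷ _ ∷ d ∷ _ ∷ _ ∷ []) 2F 1F = down d
arcs (_ ∷ _ ∷ _ ∷ _ ∷ e ∷ _ ∷ []) 3F 1F = down e
arcs (_ ∷ _ ∷ _ ∷ _ ∷ _ ∷ f ∷ []) 3F 2F = down f
arcs _ _ _ = false

hermitianᶻ : (Fin 4 → Fin 4 → Bool) → Matrixᶻ 4
hermitianᶻ a k l =
  if adj (K 4) k l ∧ not (a k l) ∧ not (a l k) then 1ᶻ else
  if a k l then iᶻ else
  if a l k then -ᶻ iᶻ else
  0ᶻ

-- For p = z⁴ + c₃ z³ + c₂ z² + c₁ z + c₀ these say that c₂ = −6 and c₃ = 0.
CoefficientIdentities : (ℤ → ℤ) → Set
CoefficientIdentities p =
  p (+ 1) ℤ.+ p (ℤ.- (+ 1)) ℤ.+ ℤ.- (+ 2) ℤ.* p (+ 0) ≡ ℤ.- (+ 10) ×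
  p (+ 2) ℤ.+ ℤ.- p (ℤ.- (+ 2)) ℤ.+ ℤ.- (+ 2) ℤ.* (p (+ 1) ℤ.+ ℤ.- p (ℤ.- (+ 1))) ≡ + 0

-- All eigenvalues have square 3

≈ᶻ-cast : ∀ {x a b} → a ≡ b → x ≈ᶻ a → x ≈ᶻ b
≈ᶻ-cast refl x≈a = x≈a

sum-nonNeg : ∀ {n} (f : Fin n → ℝ) k →
  (∀ j → 0ℚ ℚ.≤ seq (f j) k) → 0ℚ ℚ.≤ seq (sumʳ f) k
sum-nonNeg {ℕ.zero}  f k 0≤f = ℚ.≤-refl
sum-nonNeg {ℕ.suc n} f k 0≤f =
  ℚ.+-mono-≤ (0≤f zero) (sum-nonNeg (λ j → f (suc j)) k λ j → 0≤f (suc j))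

summand≤sum : ∀ {n} (f : Fin n → ℝ) k →
  (∀ j → 0ℚ ℚ.≤ seq (f j) k) → ∀ j → seq (f j) k ℚ.≤ seq (sumʳ f) k
summand≤sum f k 0≤f zero = let open ℚ.≤-Reasoning in begin
  seq (f zero) k             ≡⟨ ℚ.+-identityʳ _ ⟨
  seq (f zero) k ℚ.+ 0ℚ
    ≤⟨ ℚ.+-monoʳ-≤ (seq (f zero) k) (sum-nonNeg (λ j → f (suc j)) k λ j → 0≤f (suc j)) ⟩
  seq (sumʳ f) k             ∎
summand≤sum f k 0≤f (suc j) = let open ℚ.≤-Reasoning in begin
  seq (f (suc j)) k
    ≤⟨ summand≤sum (λ j → f (suc j)) k (λ j → 0≤f (suc j)) j ⟩
  seq (sumʳ (λ j → f (suc j))) k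
    ≡⟨ ℚ.+-identityˡ _ ⟨
  0ℚ ℚ.+ seq (sumʳ (λ j → f (suc j))) k
    ≤⟨ ℚ.+-monoˡ-≤ _ (0≤f zero) ⟩
  seq (sumʳ f) k ∎

∣p∣*∣p∣≡p*p : ∀ p → ℚ.∣ p ∣ ℚ.* ℚ.∣ p ∣ ≡ p ℚ.* p
∣p∣*∣p∣≡p*p p with ℚ.∣p∣≡p∨∣p∣≡-p p
... | inj₁ e = cong₂ ℚ._*_ e e
... | inj₂ e = trans (cong₂ ℚ._*_ e e) (solve 1 (λ a → :- a :* :- a := a :* a) refl p)

0≤p*p : ∀ p → 0ℚ ℚ.≤ p ℚ.* p
0≤p*p p = subst (0ℚ ℚ.≤_) (trans (ℚ.∣p*q∣≡∣p∣*∣q∣ p p) (∣p∣*∣p∣≡p*p p)) (ℚ.0≤∣p∣ (p ℚ.* p))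

-- At every index of the sequences, a sum of squares dominates each of its terms; so each square is
-- null, and `vanishes-√` applies.
sum-of-squares-zero : ∀ {n} (f : Fin n → ℝ) →
  Vanishes (seq (sumʳ λ j → f j *ʳ f j)) → ∀ j → Vanishes (seq (f j))
sum-of-squares-zero f v j = vanishes-√ (vanishes-dominated bound v)
  where
  bound : ∀ k → ℚ.∣ seq (f j) k ℚ.* seq (f j) k ∣ ℚ.≤ ℚ.∣ seq (sumʳ λ j → f j *ʳ f j) k ∣
  bound k = let open ℚ.≤-Reasoning in begin
    ℚ.∣ seq (f j) k ℚ.* seq (f j) k ∣
      ≡⟨ ℚ.0≤p⇒∣p∣≡p (0≤p*p (seq (f j) k)) ⟩
    seq (f j) k ℚ.* seq (f j) k
      ≤⟨ summand≤sum (λ j → f j *ʳ f j) k (λ j → 0≤p*p (seq (f j) k)) j ⟩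
    seq (sumʳ λ j → f j *ʳ f j) k
      ≡⟨ ℚ.0≤p⇒∣p∣≡p (sum-nonNeg (λ j → f j *ʳ f j) k (λ j → 0≤p*p (seq (f j) k))) ⟨
    ℚ.∣ seq (sumʳ λ j → f j *ʳ f j) k ∣ ∎

module _ (μ : Fin 4 → ℝ) where

  private
    p : ℤ → ℝ
    p z = productʳ λ j → fromℤ z +ʳ -ʳ μ j

    -1/12 : ℝ
    -1/12 = fromℚ (ℚ.- (+ 1 ℚ./ 12))

  -- The values of the polynomial at 0, ±1, ±2 fix the elementary symmetric functions e₁ and e₂ of
  -- the eigenvalues, and these determine the power sum.
  sum-of-squares : ∀ {q} → (∀ z → p z ≈ᶻ q z) → CoefficientIdentities q →
    sumʳ (λ j → μ j *ʳ μ j) ≈ᶻ + 12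
  sum-of-squares {q} p≈q (even , odd) = ⟪ vanishes-resp newton
      (vanishes-+ (vanishes-* {seq x} (cauchy x) (closeᶻ odd′)) (vanishes-neg (closeᶻ even′))) ⟫ᶻ
    where
    -- Chosen so that the product with the odd combination, which is -12 e₁, is e₁².
    x = -1/12 *ʳ (μ 0F +ʳ (μ 1F +ʳ (μ 2F +ʳ μ 3F)))
    two = fromℤ (ℤ.- (+ 2))
    two≈ : two ≈ᶻ ℤ.- (+ 2)
    two≈ = ≈ᶻ-pointwise λ _ → refl
    even′ : p (+ 1) +ʳ p (ℤ.- (+ 1)) +ʳ two *ʳ p (+ 0) ≈ᶻ ℤ.- (+ 10)
    even′ = ⟪ closeᶻ (≈ᶻ-cast even
      (≈ᶻ-+ (≈ᶻ-+ (p≈q (+ 1)) (p≈q (ℤ.- (+ 1)))) (≈ᶻ-* two≈ (p≈q (+ 0))))) ⟫ᶻ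
    odd′ : p (+ 2) +ʳ -ʳ p (ℤ.- (+ 2)) +ʳ two *ʳ (p (+ 1) +ʳ -ʳ p (ℤ.- (+ 1))) ≈ᶻ + 0
    odd′ = ⟪ closeᶻ (≈ᶻ-cast odd
      (≈ᶻ-+ (≈ᶻ-+ (p≈q (+ 2)) (≈ᶻ-neg (p≈q (ℤ.- (+ 2)))))
        (≈ᶻ-* two≈ (≈ᶻ-+ (p≈q (+ 1)) (≈ᶻ-neg (p≈q (ℤ.- (+ 1)))))))) ⟫ᶻ
    -- Newton: Σ μⱼ² = e₁² − 2 e₂, where odd is −12 e₁ and even is 2 + 2 e₂.
    newton : ∀ k → _
    newton k = solve 4 (λ a b c d →
      let K : ℤ → Polynomial 4
          K z = con (ι z)
          P : ℤ → Polynomial 4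
          -- The final `con 1ℚ` is the empty product at the end of `productʳ`; it makes the solver's
          -- expression unfold to the actual sequence.
          P z = (K z :+ :- a) :* ((K z :+ :- b) :* ((K z :+ :- c) :* ((K z :+ :- d) :* con 1ℚ)))
      in (a :* a :+ (b :* b :+ (c :* c :+ (d :* d :+ con 0ℚ)))) :+ :- K (+ 12) :=
         con (ℚ.- (+ 1 ℚ./ 12)) :* (a :+ (b :+ (c :+ d))) :*
         (P (+ 2) :+ :- P (ℤ.- (+ 2)) :+ K (ℤ.- (+ 2)) :* (P (+ 1) :+ :- P (ℤ.- (+ 1))) :+ :- K (+ 0))
         :+ :- (P (+ 1) :+ P (ℤ.- (+ 1)) :+ K (ℤ.- (+ 2)) :* P (+ 0) :+ :- K (ℤ.- (+ 10))))
      refl (seq (μ 0F) k) (seq (μ 1F) k) (seq (μ 2F) k) (seq (μ 3F) k)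

  -- Equality in Cauchy–Schwarz: Σ (|μⱼ| − s)² = Σ μⱼ² − 2s Σ |μⱼ| + 4s² = 12 − 24 + 12.
  squares-equal : ∀ s → s *ʳ s ≈ᶻ + 3 → sumʳ (λ j → μ j *ʳ μ j) ≈ᶻ + 12 →
    fromℤ (+ 4) *ʳ s ≈ʳ sumʳ (λ j → ∣ μ j ∣ʳ) →
    ∀ j → μ j *ʳ μ j ≈ᶻ + 3
  squares-equal s s²≈3 Σμ²≈12 4s≈Σ∣μ∣ j =
    ⟪ close (≈ʳ-trans (pointwise {μ j *ʳ μ j} {∣ μ j ∣ʳ *ʳ ∣ μ j ∣ʳ} λ k →
                sym (∣p∣*∣p∣≡p*p (seq (μ j) k)))
       (≈ʳ-trans (*ʳ-cong {∣ μ j ∣ʳ} {s} {∣ μ j ∣ʳ} {s} ∣μⱼ∣≈s ∣μⱼ∣≈s) (≈ᶻ⇒≈ʳ s²≈3))) ⟫ᶻ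
    where
    deviation : Fin 4 → ℝ
    deviation j = ∣ μ j ∣ʳ +ʳ -ʳ s
    -- Each summand is a Cauchy factor times the null difference from one hypothesis: 4s = Σ |μⱼ|,
    -- respectively s² = 3.
    rest : ℕ → ℚ
    rest k =
      seq (fromℤ (+ 2) *ʳ s) k ℚ.* (seq (fromℤ (+ 4) *ʳ s) k ℚ.- seq (sumʳ λ j → ∣ μ j ∣ʳ) k) ℚ.+
      ι (ℤ.- (+ 4)) ℚ.* (seq (s *ʳ s) k ℚ.- ι (+ 3))
    expansion : ∀ k → seq (sumʳ λ j → deviation j *ʳ deviation j) k ≡
      (seq (sumʳ λ j → μ j *ʳ μ j) k ℚ.- ι (+ 12)) ℚ.+ rest k
    expansion k = trans
      (solve 5 (λ a b c d s →
        let K : ℤ → Polynomial 5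
            K z = con (ι z)
            sq : Polynomial 5 → Polynomial 5
            sq a = (a :+ :- s) :* (a :+ :- s)
        in sq a :+ (sq b :+ (sq c :+ (sq d :+ con 0ℚ))) :=
           ((a :* a :+ (b :* b :+ (c :* c :+ (d :* d :+ con 0ℚ)))) :+ :- K (+ 12)) :+
           (K (+ 2) :* s :* (K (+ 4) :* s :+ :- (a :+ (b :+ (c :+ (d :+ con 0ℚ))))) :+
            K (ℤ.- (+ 4)) :* (s :* s :+ :- K (+ 3))))
        refl ℚ.∣ m 0F ∣ ℚ.∣ m 1F ∣ ℚ.∣ m 2F ∣ ℚ.∣ m 3F ∣ (seq s k))
      -- The solver treats the |μⱼ| as atoms, so |μⱼ|² is turned into μⱼ² afterwards.
      (cong (λ t → t ℚ.- ι (+ 12) ℚ.+ rest k)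
        (cong₂ ℚ._+_ (∣p∣*∣p∣≡p*p (m 0F))
        (cong₂ ℚ._+_ (∣p∣*∣p∣≡p*p (m 1F))
        (cong₂ ℚ._+_ (∣p∣*∣p∣≡p*p (m 2F))
        (cong (ℚ._+ 0ℚ) (∣p∣*∣p∣≡p*p (m 3F)))))))
      where m = λ j → seq (μ j) k
    ∣μⱼ∣≈s : ∣ μ j ∣ʳ ≈ʳ s
    ∣μⱼ∣≈s = ⟪ sum-of-squares-zero deviation (vanishes-resp expansion
      (vanishes-+ (closeᶻ Σμ²≈12)
        (vanishes-+ (vanishes-* {seq (fromℤ (+ 2) *ʳ s)} (cauchy (fromℤ (+ 2) *ʳ s)) (close 4s≈Σ∣μ∣))
          (vanishes-* {λ _ → ι (ℤ.- (+ 4))} (const-cauchy (ι (ℤ.- (+ 4)))) (closeᶻ s²≈3))))) j ⟫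

-- The product p(z) p(-z)

productʳ-* : ∀ {n} (f g : Fin n → ℝ) k →
  seq (productʳ f) k ℚ.* seq (productʳ g) k ≡ seq (productʳ λ j → f j *ʳ g j) k
productʳ-* {ℕ.zero}  f g k = refl
productʳ-* {ℕ.suc n} f g k = trans
  (solve 4 (λ x X y Y → (x :* X) :* (y :* Y) := (x :* y) :* (X :* Y)) refl
    (seq (f zero) k) (seq (productʳ λ j → f (suc j)) k)
    (seq (g zero) k) (seq (productʳ λ j → g (suc j)) k))
  (cong (seq (f zero) k ℚ.* seq (g zero) k ℚ.*_)
    (productʳ-* (λ j → f (suc j)) (λ j → g (suc j)) k))

productʳ-const : ∀ n {f : Fin n → ℝ} {a} → (∀ j → f j ≈ᶻ a) → productʳ f ≈ᶻ a ℤ.^ n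
productʳ-const ℕ.zero    f≈a = ≈ᶻ-pointwise λ _ → refl
productʳ-const (ℕ.suc n) f≈a =
  ⟪ closeᶻ (≈ᶻ-* (f≈a zero) (productʳ-const n λ j → f≈a (suc j))) ⟫ᶻ

-- p(z) p(−z) = ∏ⱼ (μⱼ² − z²) for p(z) = ∏ⱼ (z − μⱼ).
reflected-product : ∀ {n} {μ : Fin n → ℝ} {q : ℤ → ℤ} {d} →
  (∀ z → productʳ (λ j → fromℤ z +ʳ -ʳ μ j) ≈ᶻ q z) → (∀ j → μ j *ʳ μ j ≈ᶻ d) →
  ∀ z → q z ℤ.* q (ℤ.- z) ≡ (d ℤ.+ ℤ.- (z ℤ.* z)) ℤ.^ n
reflected-product {n} {μ} {q} {d} p≈q μ²≈d z = ≈ᶻ-injective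
  (≈ᶻ-* {a = q z} {q (ℤ.- z)} (p≈q z) (p≈q (ℤ.- z)))
  (≈ᶻ-resp
    (pointwise (productʳ-* (λ j → fromℤ z +ʳ -ʳ μ j) (λ j → fromℤ (ℤ.- z) +ʳ -ʳ μ j)))
    (productʳ-const n factor))
  where
  z≈z : fromℤ z ≈ᶻ z
  z≈z = ≈ᶻ-pointwise λ _ → refl
  difference-of-squares : ∀ j →
    (fromℤ z +ʳ -ʳ μ j) *ʳ (fromℤ (ℤ.- z) +ʳ -ʳ μ j) ≈ʳ μ j *ʳ μ j +ʳ -ʳ (fromℤ z *ʳ fromℤ z)
  difference-of-squares j = pointwise λ k → trans
    (cong (λ t → (ι z ℚ.+ ℚ.- seq (μ j) k) ℚ.* (t ℚ.+ ℚ.- seq (μ j) k)) (ι-neg z))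
    (solve 2 (λ z m → (z :+ :- m) :* (:- z :+ :- m) := m :* m :+ :- (z :* z)) refl
      (ι z) (seq (μ j) k))
  difference : ∀ j → μ j *ʳ μ j +ʳ -ʳ (fromℤ z *ʳ fromℤ z) ≈ᶻ d ℤ.+ ℤ.- (z ℤ.* z)
  difference j = ⟪ closeᶻ (≈ᶻ-+ (μ²≈d j) (≈ᶻ-neg (≈ᶻ-* z≈z z≈z))) ⟫ᶻ
  factor : ∀ j →
    (fromℤ z +ʳ -ʳ μ j) *ʳ (fromℤ (ℤ.- z) +ʳ -ʳ μ j) ≈ᶻ d ℤ.+ ℤ.- (z ℤ.* z)
  factor j = ≈ᶻ-resp (difference-of-squares j) (difference j)

-- Exhaustive check of the 3⁶ codes

coefficientIdentities? : ∀ p → Dec (CoefficientIdentities p)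
coefficientIdentities? p = (_ ℤ.≟ _) ×-dec (_ ℤ.≟ _)

codeCharpoly : Code → ℤ → ℤ
codeCharpoly c = charpoly (hermitianᶻ (arcs c))

sign : Fin 2 → ℤ[i]
sign 0F = 1ᶻ
sign 1F = -ᶻ 1ᶻ

signs : Vec (Fin 2) 4 → Fin 4 → ℤ[i]
signs s k = sign (lookup s k)

-- Every permutation of the four vertices has this form.
permutation : Vec (Fin 4) 3 → Permutation 4 4
permutation (a ∷ b ∷ c ∷ []) = transpose 0F a ∘ₚ transpose 1F b ∘ₚ transpose 2F c

-- The same matrix stands on both sides because a diagonal matrix of signs is its own inverse.
SwitchesTo : (Fin 4 → Fin 4 → Bool) → (Fin 4 → Fin 4 → Bool) → Vec (Fin 2) 4 → Set
SwitchesTo a b s = ∀ k l →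
  hermitianᶻ b k l ≡ (diagᶻ (signs s) *ᴹᶻ hermitianᶻ a *ᴹᶻ diagᶻ (signs s)) k l

switchesTo? : ∀ a b s → Dec (SwitchesTo a b s)
switchesTo? a b s = all? λ k → all? λ l → _ ≟ᶻ _

relabelled : Permutation 4 4 → (Fin 4 → Fin 4 → Bool) → Fin 4 → Fin 4 → Bool
relabelled π a u v = a (π ⟨$⟩ʳ u) (π ⟨$⟩ʳ v)

Classified : Code → Set
Classified c = ∃ λ p → ∃ λ s →
  SwitchesTo (relabelled (permutation p) (arcs c)) arcs-D₁ s ⊎
  SwitchesTo (relabelled (permutation p) (arcs c)) arcs-G₁ s

classified? : ∀ c → Dec (Classified c)
classified? c = any-vec? 3 λ p → any-vec? 4 λ s →
  switchesTo? (relabelled (permutation p) (arcs c)) arcs-D₁ s ⊎-dec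
  switchesTo? (relabelled (permutation p) (arcs c)) arcs-G₁ s

-- The numerals are (3 - z²)⁴ at z = 0 and z = 1.
Classifies : Code → Set
Classifies c =
  codeCharpoly c (+ 0) ℤ.* codeCharpoly c (ℤ.- (+ 0)) ≡ + 81 →
  codeCharpoly c (+ 1) ℤ.* codeCharpoly c (ℤ.- (+ 1)) ≡ + 16 →
  Classified c

classifies? : ∀ c → Dec (Classifies c)
-- A failing premise settles the implication, so relabellings and signs are searched only for codes
-- that pass both tests.
classifies? c = (_ ℤ.≟ _) →-dec ((_ ℤ.≟ _) →-dec classified? c)

abstract
  -- Decided by evaluation. It holds for every code because `H` has trace zero and each of the six
  -- edges contributes -1 to c₂.
  coefficient-identities : ∀ c → CoefficientIdentities (codeCharpoly c)
  coefficient-identities =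
    from-yes (all-vec? {3} 6 λ c → coefficientIdentities? (codeCharpoly c))

  -- Being `abstract`, the search is not evaluated again where its result is used.
  classification : ∀ c → Classifies c
  classification = from-yes (all-vec? {3} 6 classifies?)

SquaresToIdentity : Vec (Fin 2) 4 → Set
SquaresToIdentity s = ∀ k l →
  (diagᶻ (signs s) *ᴹᶻ diagᶻ (signs s)) k l ≡ diagᶻ (λ _ → 1ᶻ) k l

-- Yields both inverse laws of `SwitchingEquivalent`, with `D` in the role of `D⁻¹`.
signs-square : ∀ s → SquaresToIdentity s
signs-square = from-yes (all-vec? {2} 4 λ s → all? λ k → all? λ l →
  (diagᶻ (signs s) *ᴹᶻ diagᶻ (signs s)) k l ≟ᶻ diagᶻ (λ _ → 1ᶻ) k l)

-- Relabelling and encoding of mixed graphs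

-- Adjacency in a complete graph is inequality, and a bijection preserves and reflects it. Separate
-- `m` and `n` let this apply also to the given isomorphism with `K 4`.
K-relabel : ∀ {m n} (π : Permutation m n) u v →
  adj (K n) (π ⟨$⟩ʳ u) (π ⟨$⟩ʳ v) ≡ adj (K m) u v
K-relabel π u v with (π ⟨$⟩ʳ u) ≟ᶠ (π ⟨$⟩ʳ v) | u ≟ᶠ v
... | yes _     | yes _   = refl
... | no _      | no _    = refl
... | yes πu≡πv | no u≢v  =
  contradiction (trans (sym (Perm.inverseˡ π)) (trans (cong (π ⟨$⟩ˡ_) πu≡πv) (Perm.inverseˡ π))) u≢v
... | no πu≢πv  | yes u≡v = contradiction (cong (π ⟨$⟩ʳ_) u≡v) πu≢πv

-- The structure is pulled back along `π`, which sends new vertices to old ones; the isomorphism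
-- from `M` is therefore `flip π`.
relabel : ∀ {m n} → Permutation m n → MixedGraph n → MixedGraph m
relabel π M = record
  { underlying = record
    { adj        = λ u v → adj (underlying M) (π ⟨$⟩ʳ u) (π ⟨$⟩ʳ v)
    ; adj-sym    = λ u v → adj-sym (underlying M) (π ⟨$⟩ʳ u) (π ⟨$⟩ʳ v)
    ; adj-irrefl = λ v → adj-irrefl (underlying M) (π ⟨$⟩ʳ v)
    }
  ; arc        = λ u v → arc M (π ⟨$⟩ʳ u) (π ⟨$⟩ʳ v)
  ; arc⇒adj    = λ u v → arc⇒adj M (π ⟨$⟩ʳ u) (π ⟨$⟩ʳ v)
  ; arc-asym   = λ u v → arc-asym M (π ⟨$⟩ʳ u) (π ⟨$⟩ʳ v)
  }

relabel-≅ : ∀ {m n} (π : Permutation m n) (M : MixedGraph n) → M ≅ relabel π M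
relabel-≅ π M = flip π , λ u v →
  sym (cong₂ (undirected M) (Perm.inverseʳ π) (Perm.inverseʳ π)) ,
  sym (cong₂ (arc M) (Perm.inverseʳ π) (Perm.inverseʳ π))

-- Two arcs in opposite directions never occur; `down-orientation` excludes them by asymmetry.
orientation : Bool → Bool → Fin 3
orientation true  _     = 1F
orientation false true  = 2F
orientation false false = 0F

up-orientation : ∀ a b → a ≡ up (orientation a b)
up-orientation true  _     = refl
up-orientation false true  = refl
up-orientation false false = refl

down-orientation : ∀ a b → (T a → ¬ T b) → b ≡ down (orientation a b)
down-orientation true  true  asym = contradiction tt (asym tt)
down-orientation true  false asym = refl
down-orientation false true  asym = refl
down-orientation false false asym = refl

encode : MixedGraph 4 → Code
encode M = e 0F 1F ∷ e 0F 2F ∷ e 0F 3F ∷ e 1F 2F ∷ e 1F 3F ∷ e 2F 3F ∷ []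
  where
  e : Fin 4 → Fin 4 → Fin 3
  e u v = orientation (arc M u v) (arc M v u)

-- The code records each pair once, in increasing order. Asymmetry recovers the reverse arcs and, at
-- `u = v`, rules out loops.
arcs-encode : ∀ M u v → arc M u v ≡ arcs (encode M) u v
arcs-encode M = λ where
    0F 0F → loopless 0F
    0F 1F → upward 0F 1F
    0F 2F → upward 0F 2F
    0F 3F → upward 0F 3F
    1F 0F → downward 0F 1F
    1F 1F → loopless 1F
    1F 2F → upward 1F 2F
    1F 3F → upward 1F 3F
    2F 0F → downward 0F 2F
    2F 1F → downward 1F 2F
    2F 2F → loopless 2F
    2F 3F → upward 2F 3F
    3F 0F → downward 0F 3F
    3F 1F → downward 1F 3F
    3F 2F → downward 2F 3F
    3F 3F → loopless 3F
  where
  upward : ∀ u v → arc M u v ≡ up (orientation (arc M u v) (arc M v u))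
  upward u v = up-orientation (arc M u v) (arc M v u)
  downward : ∀ u v → arc M v u ≡ down (orientation (arc M u v) (arc M v u))
  downward u v = down-orientation (arc M u v) (arc M v u) (arc-asym M u v)
  loopless : ∀ v → arc M v v ≡ false
  loopless v with arc M v v | arc-asym M v v
  ... | true  | asym = contradiction tt (asym tt)
  ... | false | _    = refl

-- Switching equivalence from Gaussian-integer computations

≐-cast : ∀ {z w w′} → w ≡ w′ → z ≐ w → z ≐ w′
≐-cast refl z≐w = z≐w

entry≐ : ∀ {u u′ a a′ b b′} → u ≡ u′ → a ≡ a′ → b ≡ b′ →
  (if u then 1ᶜ else if a then iᶜ else if b then -ᶜ iᶜ else 0ᶜ) ≐
  (if u′ then 1ᶻ else if a′ then iᶻ else if b′ then -ᶻ iᶻ else 0ᶻ)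
entry≐ {true}                          refl refl refl = 1ᶜ≐1ᶻ
entry≐ {false} {a = true}              refl refl refl = iᶜ≐iᶻ
entry≐ {false} {a = false} {b = true}  refl refl refl = ≐-neg iᶜ≐iᶻ
entry≐ {false} {a = false} {b = false} refl refl refl = 0ᶜ≐0ᶻ

hermitian≐ : ∀ (M : MixedGraph 4) a →
  (∀ u v → adj (underlying M) u v ≡ adj (K 4) u v) → (∀ u v → arc M u v ≡ a u v) →
  hermitianAdjacency M ≐ᴹ hermitianᶻ a
hermitian≐ M a adj≡ arc≡ k l = entry≐
  (cong₂ _∧_ (adj≡ k l) (cong₂ (λ x y → not x ∧ not y) (arc≡ k l) (arc≡ l k)))
  (arc≡ k l) (arc≡ l k)

switching : ∀ (M N : MixedGraph 4) {a b : Fin 4 → Fin 4 → Bool} s →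
  (∀ u v → adj (underlying M) u v ≡ adj (K 4) u v) → (∀ u v → arc M u v ≡ a u v) →
  (∀ u v → adj (underlying N) u v ≡ adj (K 4) u v) → (∀ u v → arc N u v ≡ b u v) →
  SwitchesTo a b s → SwitchingEquivalent M N
switching M N {a} {b} s adjM arcM adjN arcN switches =
  (λ u v → trans (adjM u v) (sym (adjN u v))) ,
  -- The inverse of `D` is `D` itself, so one proof covers both products.
  d , diag d , (λ k → ±1 (lookup s k)) , (D²≃1 , D²≃1) , H′≃DHD
  where
  signᶜ : Fin 2 → ℂ
  signᶜ 0F = 1ᶜ
  signᶜ 1F = -ᶜ 1ᶜ
  d : Fin 4 → ℂ
  d k = signᶜ (lookup s k)
  ±1 : ∀ e → signᶜ e ≃ᶜ 1ᶜ ⊎ signᶜ e ≃ᶜ -ᶜ 1ᶜ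
  ±1 0F = inj₁ (≐-cancel 1ᶜ≐1ᶻ 1ᶜ≐1ᶻ)
  ±1 1F = inj₂ (≐-cancel (≐-neg 1ᶜ≐1ᶻ) (≐-neg 1ᶜ≐1ᶻ))
  sign≐ : ∀ e → signᶜ e ≐ sign e
  sign≐ 0F = 1ᶜ≐1ᶻ
  sign≐ 1F = ≐-neg 1ᶜ≐1ᶻ
  D≐ : diag d ≐ᴹ diagᶻ (signs s)
  D≐ = ≐-diag λ k → sign≐ (lookup s k)
  D²≃1 : diag d *ᴹ diag d ≃ᴹ 1ᴹ
  D²≃1 k l = ≐-cancel (≐-cast (signs-square s k l) (≐-*ᴹ D≐ D≐ k l))
    (≐-diag (λ _ → 1ᶜ≐1ᶻ) k l)
  H′≃DHD : hermitianAdjacency N ≃ᴹ diag d *ᴹ hermitianAdjacency M *ᴹ diag d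
  H′≃DHD k l = ≐-cancel (≐-cast (switches k l) (hermitian≐ N b adjN arcN k l))
    (≐-*ᴹ (≐-*ᴹ D≐ (hermitian≐ M a adjM arcM)) D≐ k l)

-- Conclusion for K₄

classify-K₄ : (M : MixedGraph 4) → Regular 3 (underlying M) → OptimumHermitianEnergy M →
  (∀ u v → adj (underlying M) u v ≡ adj (K 4) u v) →
  ∃ λ (N : MixedGraph 4) → M ≅ N × (SwitchingEquivalent N D₁ ⊎ SwitchingEquivalent N G₁)
classify-K₄ M regular (s , (_ , s²≃Δ) , μ , eigenvalues , 4s≃Σ∣μ∣) adj≡ =
  -- The right sides of `reflection` at 0 and 1 evaluate to 81 and 16.
  conclude (classification c (reflection (+ 0)) (reflection (+ 1)))
  where
  c = encode M
  maxDegree≡3 : maxDegree (underlying M) ≡ 3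
  -- The fold for the maximum ends in the default 0, which the degrees 3 absorb.
  maxDegree≡3 = cong₂ ℕ._⊔_ (regular 0F) (cong₂ ℕ._⊔_ (regular 1F)
    (cong₂ ℕ._⊔_ (regular 2F) (cong (ℕ._⊔ 0) (regular 3F))))
  s²≈3 : s *ʳ s ≈ᶻ + 3
  -- With the numeral 3 for `Δ`, the sequence of `fromℕ Δ` evaluates to that of `fromℤ (+ 3)`.
  s²≈3 = ⟪ subst (λ Δ → s *ʳ s ≃ʳ fromℕ Δ) maxDegree≡3 s²≃Δ ⟫ᶻ
  4s≈Σ∣μ∣ : fromℤ (+ 4) *ʳ s ≈ʳ sumʳ (λ j → ∣ μ j ∣ʳ)
  4s≈Σ∣μ∣ = ⟪ 4s≃Σ∣μ∣ ⟫
  roots : ∀ z → productʳ (λ j → fromℤ z +ʳ -ʳ μ j) ≈ᶻ codeCharpoly c z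
  roots = charpoly-roots (hermitianAdjacency M) (hermitianᶻ (arcs c)) μ
    (hermitian≐ M (arcs c) adj≡ (arcs-encode M)) eigenvalues
  reflection : ∀ z → codeCharpoly c z ℤ.* codeCharpoly c (ℤ.- z) ≡ (+ 3 ℤ.+ ℤ.- (z ℤ.* z)) ℤ.^ 4
  reflection = reflected-product {μ = μ} {codeCharpoly c} roots
    (squares-equal μ s s²≈3 (sum-of-squares μ roots (coefficient-identities c)) 4s≈Σ∣μ∣)
  conclude : Classified c → ∃ λ (N : MixedGraph 4) →
    M ≅ N × (SwitchingEquivalent N D₁ ⊎ SwitchingEquivalent N G₁)
  conclude (p , e , switches) = relabel π M , relabel-≅ π M , equivalent switches
    where
    π = permutation p
    adjN : ∀ u v → adj (underlying (relabel π M)) u v ≡ adj (K 4) u v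
    adjN u v = trans (adj≡ (π ⟨$⟩ʳ u) (π ⟨$⟩ʳ v)) (K-relabel π u v)
    arcN : ∀ u v → arc (relabel π M) u v ≡ relabelled π (arcs c) u v
    arcN u v = arcs-encode M (π ⟨$⟩ʳ u) (π ⟨$⟩ʳ v)
    equivalent : SwitchesTo (relabelled π (arcs c)) arcs-D₁ e ⊎
                 SwitchesTo (relabelled π (arcs c)) arcs-G₁ e →
                 SwitchingEquivalent (relabel π M) D₁ ⊎ SwitchingEquivalent (relabel π M) G₁
    equivalent (inj₁ to-D₁) = inj₁
      (switching (relabel π M) D₁ e adjN arcN (λ _ _ → refl) (λ _ _ → refl) to-D₁)
    equivalent (inj₂ to-G₁) = inj₂
      (switching (relabel π M) G₁ e adjN arcN (λ _ _ → refl) (λ _ _ → refl) to-G₁)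

theorem3p1 : ∀ {n} (M : MixedGraph n) →
    Regular 3 (underlying M) →
    OptimumHermitianEnergy M →
    underlying M ≅ᴳ K 4 →
    ∃ λ (N : MixedGraph 4) →
    M ≅ N × (SwitchingEquivalent N D₁ ⊎ SwitchingEquivalent N G₁)
theorem3p1 M regular optimum (π , iso) = order-four (↔⇒≡ π) M regular optimum
    λ u v → trans (iso u v) (K-relabel π u v)
  where
  -- The bijection with `Fin 4` forces `n ≡ 4`; quantifying afresh over `n`, `M` and the hypotheses
  -- allows that equation to be matched with `refl`.
  order-four : ∀ {n} → n ≡ 4 → (M : MixedGraph n) →
    Regular 3 (underlying M) → OptimumHermitianEnergy M →
    (∀ u v → adj (underlying M) u v ≡ adj (K n) u v) →
    ∃ λ (N : MixedGraph 4) → M ≅ N × (SwitchingEquivalent N D₁ ⊎ SwitchingEquivalent N G₁)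
  order-four refl = classify-K₄
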